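{- Let $q\ge2$ and let $\rho,\lambda,\kappa$ be nonnegative integers with $P(\lambda+\kappa+1)\le\rho$ and $\rho\le\frac34\lambda$. Let $B$ be the set of integers $0\le l<q^\lambda$ for which there exist integers $0\le k_1,k_2<q^\kappa$ with \[ a_P(lq^\kappa+k_1+k_2)-a_P(lq^\kappa+k_1)\ne a_P^{(\kappa+\rho)}(lq^\kappa+k_1+k_2)-a_P^{(\kappa+\rho)}(lq^\kappa+k_1). \] Then $\#B\ll q^{\lambda-\rho+P(\lambda+\kappa+1)}$.
   Context: $P:\mathbb{N}\to\mathbb{N}$ is nondecreasing. Digits: $n=\sum_j\varepsilon_j(n)q^j$, $\varepsilon_j(n)\in\{0,\dots,q-1\}$; $T_q(n)=\lfloor\log n/\log q\rfloor$ for $n\ge1$ ($T_q(0)$ may be given any fixed integer value). $a_P(x,y)=\sum_{i\ge0}\prod_{j=i}^{i+P(y)}\varepsilon_j(x)$, $a_P(n)=a_P(n,T_q(n))$, and for an integer $\rho'\ge0$, $a_P^{(\rho')}(n)=a_P(n\bmod q^{\rho'},T_q(n))$ (note the second argument is $T_q(n)$, not $T_q(n\bmod q^{\rho'})$). The implied constant depends only on $q$. -}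

module Defs where

open import Data.Nat using (ℕ; zero; suc; _+_; _*_; _∸_; _^_; _≤_; _/_; _%_; _⊔_; _≤ᵇ_; NonZero)
open import Data.Nat.Properties using (m^n≢0)
open import Data.List using (List; upTo; map; filter; foldr; length)
open import Data.Nat.ListAction using (sum; product)
open import Data.Bool using (Bool; true; false; not; T)
open import Data.Bool.ListAction using (any)
open import Data.Integer as ℤ using (ℤ; +_)
open import Relation.Nullary using (does)

Nondecreasing : (ℕ → ℕ) → Set
Nondecreasing P = ∀ m n → m ≤ n → P m ≤ P n

module _ (q : ℕ) .⦃ q≢0 : NonZero q ⦄ where

  digit : ℕ → ℕ → ℕ
  digit j n = (_/_ n (q ^ j) ⦃ m^n≢0 q j ⦄) % q

  -- T_q(n) = ⌊log n / log q⌋ = largest j with q^j ≤ n  (T_q(0) := 0)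
  Tq : ℕ → ℕ
  Tq n = foldr _⊔_ 0 (filter (λ j → Data.Nat._≤?_ (q ^ j) n) (upTo (suc n)))

  -- a_P(x,y) = Σ_{i≥0} ∏_{j=i}^{i+P(y)} ε_j(x); terms with i > x vanish (ε_i(x)=0),
  -- so the sum is over 0 ≤ i ≤ x.
  aPxy : (ℕ → ℕ) → ℕ → ℕ → ℕ
  aPxy P x y = sum (map (λ i → product (map (λ t → digit (i + t) x) (upTo (suc (P y))))) (upTo (suc x)))

  aP : (ℕ → ℕ) → ℕ → ℕ
  aP P n = aPxy P n (Tq n)

  aPtrunc : (ℕ → ℕ) → ℕ → ℕ → ℕ
  aPtrunc P ρ' n = aPxy P (_%_ n (q ^ ρ') ⦃ m^n≢0 q ρ' ⦄) (Tq n)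

  inB : (ℕ → ℕ) → ℕ → ℕ → ℕ → Bool
  inB P ρ κ l =
    any (λ k₁ → any (λ k₂ →
      let m₁ = l * q ^ κ + k₁ + k₂
          m₀ = l * q ^ κ + k₁
      in not (does ((+ aP P m₁ ℤ.- + aP P m₀) ℤ.≟ (+ aPtrunc P (κ + ρ) m₁ ℤ.- + aPtrunc P (κ + ρ) m₀))))
      (upTo (q ^ κ))) (upTo (q ^ κ))

  cardB : (ℕ → ℕ) → ℕ → ℕ → ℕ → ℕ
  cardB P ρ λ' κ = length (filter (λ l → T? (inB P ρ κ l)) (upTo (q ^ λ')))
    where
    T? : (b : Bool) → Relation.Nullary.Dec (T b)
    T? true = Relation.Nullary.yes _
    T? false = Relation.Nullary.no (λ ())

-- Put p = P(λ+κ+1) and r = ρ − p.  If q^r ∤ l+1, then for k₁, k₂ < q^κ the numbers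
-- m₀ = l q^κ + k₁ and m₁ = m₀ + k₂ have the same digits from position κ + r on (m₁ div q^κ
-- is l or l + 1, and q^r ∤ l+1 makes both have the same quotient by q^r), hence also the
-- same T_q.  A window of P(T_q m₀) + 1 ≤ p + 1 consecutive digits either ends below κ + ρ, where
-- reduction mod q^(κ+ρ) changes nothing, or starts at or above κ + r, where the windows of
-- m₀ and m₁ agree and those of the reductions vanish.  Summing windows, the increments of
-- a_P and of a_P^(κ+ρ) from m₀ to m₁ coincide.  So every l ∈ B has q^r ∣ l+1, and there are
-- exactly q^λ / q^r = q^(λ−ρ+p) such l < q^λ (ρ ≤ λ since 4ρ ≤ 3λ); the constant is 1.

module Submission where

open import Defs
open import Data.Nat using (ℕ; zero; suc; _+_; _*_; _∸_; _^_; _≤_; _<_; _≤′_; _⊔_; z≤n; s≤s; s≤s⁻¹; ≤′-refl; ≤′-step; NonZero)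
open import Data.Nat.Properties
open import Data.Nat.DivMod
open import Data.Nat.Divisibility using (_∣_; _∣?_; divides; n∣m*n; n∣m⇒m%n≡0)
open import Data.Nat.ListAction using (sum; product)
open import Data.Nat.ListAction.Properties using (sum-++)
open import Data.List using ([]; _∷_; [_]; _++_; upTo; map; filter; foldr; length)
open import Data.List.Properties using (upTo-∷ʳ; map-++; map-cong-local; filter-++; length-++; filter-accept; filter-reject)
import Data.List.Relation.Unary.All as All
open import Data.List.Relation.Unary.All.Properties using (all-upTo)
open import Data.List.Relation.Unary.Any using (here; there)
open import Data.List.Relation.Unary.Any.Properties using (any⁻)
open import Data.List.Membership.Propositional using (_∈_; find)
open import Data.List.Membership.Propositional.Properties using (∈-upTo⁺; ∈-upTo⁻; ∈-filter⁺; ∈-filter⁻; foldr-selective)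
open import Algebra.Properties.CommutativeSemigroup +-commutativeSemigroup using (interchange)
import Data.Integer as ℤ
import Data.Integer.Properties as ℤ
open import Data.Product using (∃-syntax; _×_; _,_; proj₂)
open import Data.Sum using (_⊎_; inj₁; inj₂; [_,_]′)
open import Relation.Binary.PropositionalEquality hiding ([_])
open import Function using (_∘_)
open import Relation.Nullary using (¬_; yes; no; contradiction)
open import Relation.Nullary.Decidable using (dec-true)
open import Data.Bool using (T; not)
open import Data.Empty using (⊥-elim)
open import Relation.Unary using (Pred; Decidable)
open import Level using (0ℓ)

sum-upTo-suc : ∀ (f : ℕ → ℕ) n → sum (map f (upTo (suc n))) ≡ sum (map f (upTo n)) + f n
sum-upTo-suc f n = begin
  sum (map f (upTo (suc n)))               ≡⟨ cong (sum ∘ map f) (upTo-∷ʳ n) ⟨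
  sum (map f (upTo n ++ [ n ]))            ≡⟨ cong sum (map-++ f (upTo n) [ n ]) ⟩
  sum (map f (upTo n) ++ [ f n ])          ≡⟨ sum-++ (map f (upTo n)) [ f n ] ⟩
  sum (map f (upTo n)) + (f n + 0)         ≡⟨ cong (sum (map f (upTo n)) +_) (+-identityʳ (f n)) ⟩
  sum (map f (upTo n)) + f n               ∎
  where open ≡-Reasoning

sum-upTo-vanishing : ∀ (f : ℕ → ℕ) {m n} → m ≤ n → (∀ i → m ≤ i → f i ≡ 0) →
  sum (map f (upTo n)) ≡ sum (map f (upTo m))
sum-upTo-vanishing f {m} m≤n f≡0 = go (≤⇒≤′ m≤n)
  where
  go : ∀ {n} → m ≤′ n → sum (map f (upTo n)) ≡ sum (map f (upTo m))
  go ≤′-refl = refl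
  go (≤′-step {n} m≤′n) = begin
    sum (map f (upTo (suc n))) ≡⟨ sum-upTo-suc f n ⟩
    sum (map f (upTo n)) + f n ≡⟨ cong₂ _+_ (go m≤′n) (f≡0 n (≤′⇒≤ m≤′n)) ⟩
    sum (map f (upTo m)) + 0   ≡⟨ +-identityʳ _ ⟩
    sum (map f (upTo m))       ∎
    where open ≡-Reasoning

sum-map-interchange : ∀ {f g h k : ℕ → ℕ} → (∀ i → f i + g i ≡ h i + k i) → ∀ xs →
  sum (map f xs) + sum (map g xs) ≡ sum (map h xs) + sum (map k xs)
sum-map-interchange eq [] = refl
sum-map-interchange {f} {g} {h} {k} eq (x ∷ xs) = begin
  (f x + F) + (g x + G) ≡⟨ interchange (f x) F (g x) G ⟩
  (f x + g x) + (F + G) ≡⟨ cong₂ _+_ (eq x) (sum-map-interchange eq xs) ⟩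
  (h x + k x) + (H + K) ≡⟨ interchange (h x) (k x) H K ⟩
  (h x + H) + (k x + K) ∎
  where
  open ≡-Reasoning
  F G H K : ℕ
  F = sum (map f xs)
  G = sum (map g xs)
  H = sum (map h xs)
  K = sum (map k xs)

product-upTo-cong : ∀ {f g : ℕ → ℕ} n → (∀ {t} → t < n → f t ≡ g t) →
  product (map f (upTo n)) ≡ product (map g (upTo n))
product-upTo-cong n eq = cong product (map-cong-local (All.map eq (all-upTo n)))

product-map-zero : ∀ (f : ℕ → ℕ) {t xs} → t ∈ xs → f t ≡ 0 → product (map f xs) ≡ 0
product-map-zero f {xs = _ ∷ xs} (here refl) ft≡0 = cong (_* product (map f xs)) ft≡0
product-map-zero f {xs = x ∷ _} (there t∈xs) ft≡0 =
  trans (cong (f x *_) (product-map-zero f t∈xs ft≡0)) (*-zeroʳ (f x))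

length-filter-mono : ∀ {P Q : Pred ℕ 0ℓ} (P? : Decidable P) (Q? : Decidable Q) xs →
  (∀ {x} → x ∈ xs → P x → Q x) → length (filter P? xs) ≤ length (filter Q? xs)
length-filter-mono P? Q? [] P⇒Q = z≤n
length-filter-mono P? Q? (x ∷ xs) P⇒Q with P? x | Q? x
... | yes Px | yes _  = s≤s (length-filter-mono P? Q? xs (P⇒Q ∘ there))
... | yes Px | no ¬Qx = contradiction (P⇒Q (here refl) Px) ¬Qx
... | no _   | yes _  = m≤n⇒m≤1+n (length-filter-mono P? Q? xs (P⇒Q ∘ there))
... | no _   | no _   = length-filter-mono P? Q? xs (P⇒Q ∘ there)

≤-foldr-⊔ : ∀ {j xs} → j ∈ xs → j ≤ foldr _⊔_ 0 xs
≤-foldr-⊔ {xs = _ ∷ xs} (here refl) = m≤m⊔n _ (foldr _⊔_ 0 xs)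
≤-foldr-⊔ {xs = x ∷ _}  (there j∈xs) = ≤-trans (≤-foldr-⊔ j∈xs) (m≤n⊔m x _)

m+p≡n+o⇒+m-+n≡+o-+p : ∀ m n o p → m + p ≡ n + o → ℤ.+ m ℤ.- ℤ.+ n ≡ ℤ.+ o ℤ.- ℤ.+ p
m+p≡n+o⇒+m-+n≡+o-+p m n o p eq = begin
  ℤ.+ m ℤ.- ℤ.+ n       ≡⟨ ℤ.[+m]-[+n]≡m⊖n m n ⟩
  m ℤ.⊖ n               ≡⟨ ℤ.+-cancelˡ-⊖ p m n ⟨
  (p + m) ℤ.⊖ (p + n)   ≡⟨ cong₂ ℤ._⊖_ (trans (+-comm p m) eq) (+-comm p n) ⟩
  (n + o) ℤ.⊖ (n + p)   ≡⟨ ℤ.+-cancelˡ-⊖ n o p ⟩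
  o ℤ.⊖ p               ≡⟨ ℤ.[+m]-[+n]≡m⊖n o p ⟨
  ℤ.+ o ℤ.- ℤ.+ p       ∎
  where open ≡-Reasoning

[m+kn]/n≡k : ∀ {m n} k .⦃ _ : NonZero n ⦄ → m < n → (m + k * n) / n ≡ k
[m+kn]/n≡k {m} {n} k m<n = begin
  (m + k * n) / n   ≡⟨ +-distrib-/-∣ʳ m (n∣m*n k) ⟩
  m / n + k * n / n ≡⟨ cong₂ _+_ (m<n⇒m/n≡0 m<n) (m*n/n≡m k n) ⟩
  k                 ∎
  where open ≡-Reasoning

[kn+m]/n≡k+m/n : ∀ k m {n} .⦃ _ : NonZero n ⦄ → (k * n + m) / n ≡ k + m / n
[kn+m]/n≡k+m/n k m {n} = trans (+-distrib-/-∣ˡ m (n∣m*n k)) (cong (_+ m / n) (m*n/n≡m k n))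

module _ (d : ℕ) .⦃ _ : NonZero d ⦄ where

  suc-/-view : ∀ n → (¬ d ∣ suc n × suc n / d ≡ n / d) ⊎ (d ∣ suc n × suc n / d ≡ suc (n / d))
  suc-/-view n with m≤n⇒m<n∨m≡n (m%n<n n d)
  ... | inj₁ 1+r<d = inj₁ (d∤1+n , trans (cong (_/ d) 1+n≡) ([m+kn]/n≡k (n / d) 1+r<d))
    where
    1+n≡ : suc n ≡ suc (n % d) + n / d * d
    1+n≡ = cong suc (m≡m%n+[m/n]*n n d)
    d∤1+n : ¬ d ∣ suc n
    d∤1+n d∣1+n = 0≢1+n (begin
      0                            ≡⟨ n∣m⇒m%n≡0 (suc n) d d∣1+n ⟨
      suc n % d                    ≡⟨ cong (_% d) 1+n≡ ⟩
      (suc (n % d) + n / d * d) % d ≡⟨ [m+kn]%n≡m%n (suc (n % d)) (n / d) d ⟩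
      suc (n % d) % d              ≡⟨ m<n⇒m%n≡m 1+r<d ⟩
      suc (n % d)                  ∎)
      where open ≡-Reasoning
  ... | inj₂ 1+r≡d = inj₂ (divides (suc (n / d)) 1+n≡ , trans (cong (_/ d) 1+n≡) (m*n/n≡m (suc (n / d)) d))
    where
    1+n≡ : suc n ≡ suc (n / d) * d
    1+n≡ = trans (cong suc (m≡m%n+[m/n]*n n d)) (cong (_+ n / d * d) 1+r≡d)

  suc-/-∤ : ∀ {n} → ¬ d ∣ suc n → suc n / d ≡ n / d
  suc-/-∤ {n} d∤1+n with suc-/-view n
  ... | inj₁ (_ , eq)    = eq
  ... | inj₂ (d∣1+n , _) = contradiction d∣1+n d∤1+n

  count-∣-suc : ∀ n → length (filter (λ l → d ∣? suc l) (upTo n)) ≡ n / d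
  count-∣-suc zero    = sym (0/n≡0 d)
  count-∣-suc (suc n) = begin
    length (filter D? (upTo (suc n)))                ≡⟨ cong (length ∘ filter D?) (upTo-∷ʳ n) ⟨
    length (filter D? (upTo n ++ [ n ]))             ≡⟨ cong length (filter-++ D? (upTo n) [ n ]) ⟩
    length (filter D? (upTo n) ++ filter D? [ n ])   ≡⟨ length-++ (filter D? (upTo n)) ⟩
    length (filter D? (upTo n)) + length (filter D? [ n ]) ≡⟨ cong (_+ length (filter D? [ n ])) (count-∣-suc n) ⟩
    n / d + length (filter D? [ n ])                 ≡⟨ last-step (suc-/-view n) ⟩
    suc n / d                                        ∎
    where
    open ≡-Reasoning
    D? : Decidable (λ l → d ∣ suc l)
    D? l = d ∣? suc l
    last-step : (¬ d ∣ suc n × suc n / d ≡ n / d) ⊎ (d ∣ suc n × suc n / d ≡ suc (n / d)) →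
      n / d + length (filter D? [ n ]) ≡ suc n / d
    last-step (inj₁ (d∤1+n , eq)) = trans (cong (λ xs → n / d + length xs) (filter-reject D? d∤1+n))
                                          (trans (+-identityʳ (n / d)) (sym eq))
    last-step (inj₂ (d∣1+n , eq)) = trans (cong (λ xs → n / d + length xs) (filter-accept D? d∣1+n))
                                          (trans (+-comm (n / d) 1) (sym eq))

/-/-carry-free : ∀ {d e} .⦃ _ : NonZero d ⦄ .⦃ _ : NonZero e ⦄ {l k₁ k₂} →
  ¬ e ∣ suc l → k₁ < d → k₂ < d → (l * d + k₁) / d / e ≡ (l * d + k₁ + k₂) / d / e
/-/-carry-free {d} {e} {l} {k₁} {k₂} e∤1+l k₁<d k₂<d = begin
  (l * d + k₁) / d / e          ≡⟨ cong (_/ e) ([kn+m]/n≡k+m/n l k₁) ⟩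
  (l + k₁ / d) / e              ≡⟨ no-carry (k₁ / d) (small k₁<2d) ⟩
  l / e                         ≡⟨ no-carry ((k₁ + k₂) / d) (small k₁+k₂<2d) ⟨
  (l + (k₁ + k₂) / d) / e       ≡⟨ cong (_/ e) ([kn+m]/n≡k+m/n l (k₁ + k₂)) ⟨
  (l * d + (k₁ + k₂)) / d / e   ≡⟨ cong (λ x → x / d / e) (+-assoc (l * d) k₁ k₂) ⟨
  (l * d + k₁ + k₂) / d / e     ∎
  where
  open ≡-Reasoning
  small : ∀ {k} → k < 2 * d → k / d ≤ 1
  small k<2d = s≤s⁻¹ (m<n*o⇒m/o<n k<2d)
  k₁+k₂<2d : k₁ + k₂ < 2 * d
  k₁+k₂<2d = <-≤-trans (+-mono-< k₁<d k₂<d) (≤-reflexive (cong (d +_) (sym (+-identityʳ d))))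
  k₁<2d : k₁ < 2 * d
  k₁<2d = <-≤-trans k₁<d (m≤m+n d (d + 0))
  no-carry : ∀ c → c ≤ 1 → (l + c) / e ≡ l / e
  no-carry zero    _         = cong (_/ e) (+-identityʳ l)
  no-carry (suc zero) _      = trans (cong (_/ e) (+-comm l 1)) (suc-/-∤ e e∤1+l)
  no-carry (suc (suc _)) (s≤s ())

m∸[n∸o]≡m∸n+o : ∀ {m n o} → o ≤ n → n ≤ m → m ∸ (n ∸ o) ≡ m ∸ n + o
m∸[n∸o]≡m∸n+o {m} {n} {o} o≤n n≤m = begin
  m ∸ (n ∸ o)           ≡⟨ cong (_∸ (n ∸ o)) (m∸n+n≡m n≤m) ⟨
  (m ∸ n + n) ∸ (n ∸ o) ≡⟨ +-∸-assoc (m ∸ n) (m∸n≤m n o) ⟩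
  m ∸ n + (n ∸ (n ∸ o)) ≡⟨ cong (m ∸ n +_) (m∸[m∸n]≡n o≤n) ⟩
  m ∸ n + o             ∎
  where open ≡-Reasoning

module Digits (q : ℕ) .⦃ _ : NonZero q ⦄ where

  q^≢0 : ∀ n → NonZero (q ^ n)
  q^≢0 n = m^n≢0 q n

  -- Instance search cannot solve q ^ ?n = q ^ n, so the divisor proofs for powers of q are passed by hand.
  infixl 7 _/q^_ _%q^_
  _/q^_ _%q^_ : ℕ → ℕ → ℕ
  x /q^ n = _/_ x (q ^ n) ⦃ q^≢0 n ⦄
  x %q^ n = _%_ x (q ^ n) ⦃ q^≢0 n ⦄

  q^n≡q^[n∸m]*q^m : ∀ {m n} → m ≤ n → q ^ n ≡ q ^ (n ∸ m) * q ^ m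
  q^n≡q^[n∸m]*q^m {m} {n} m≤n = trans (cong (q ^_) (sym (m∸n+n≡m m≤n))) (^-distribˡ-+-* q (n ∸ m) m)

  q^n/q^m≡q^[n∸m] : ∀ {m n} → m ≤ n → q ^ n /q^ m ≡ q ^ (n ∸ m)
  q^n/q^m≡q^[n∸m] {m} {n} m≤n =
    trans (cong (_/q^ m) (q^n≡q^[n∸m]*q^m m≤n)) (m*n/n≡m (q ^ (n ∸ m)) (q ^ m) ⦃ q^≢0 m ⦄)

  /q^-+ : ∀ x m n → x /q^ (m + n) ≡ x /q^ m /q^ n
  /q^-+ x m n = trans (/-congʳ ⦃ q^≢0 (m + n) ⦄ ⦃ q^m*q^n≢0 ⦄ (^-distribˡ-+-* q m n))
                      (sym (m/n/o≡m/[n*o] x (q ^ m) (q ^ n) ⦃ q^≢0 m ⦄ ⦃ q^≢0 n ⦄ ⦃ q^m*q^n≢0 ⦄))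
    where
    q^m*q^n≢0 : NonZero (q ^ m * q ^ n)
    q^m*q^n≢0 = m*n≢0 (q ^ m) (q ^ n) ⦃ q^≢0 m ⦄ ⦃ q^≢0 n ⦄

  /q^-≤ : ∀ {m n} j → m ≤ n → m /q^ j ≤ n /q^ j
  /q^-≤ j = /-monoˡ-≤ (q ^ j) ⦃ q^≢0 j ⦄

  q^M≤-cong-/ : ∀ M {x y} → q ^ M ≤ x → x /q^ M ≡ y /q^ M → q ^ M ≤ y
  q^M≤-cong-/ M q^M≤x eq = m/n≢0⇒n≤m ⦃ q^≢0 M ⦄
    (λ y/q^M≡0 → >⇒≢ (m≥n⇒m/n>0 ⦃ q^≢0 M ⦄ q^M≤x) (trans eq y/q^M≡0))

  q^j≤-cong-/ : ∀ M {x y} → q ^ M ≤ x → x /q^ M ≡ y /q^ M → ∀ j → q ^ j ≤ x → q ^ j ≤ y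
  q^j≤-cong-/ M {x} {y} q^M≤x eq j q^j≤x = [ below , above ]′ (≤-total j M)
    where
    open ≤-Reasoning
    below : j ≤ M → q ^ j ≤ y
    below j≤M = ≤-trans (^-monoʳ-≤ q j≤M) (q^M≤-cong-/ M q^M≤x eq)
    above : M ≤ j → q ^ j ≤ y
    above M≤j = begin
      q ^ j                         ≡⟨ q^n≡q^[n∸m]*q^m M≤j ⟩
      q ^ (j ∸ M) * q ^ M           ≤⟨ *-monoˡ-≤ (q ^ M) q^[j∸M]≤y/q^M ⟩
      y /q^ M * q ^ M               ≤⟨ m/n*n≤m y (q ^ M) ⦃ q^≢0 M ⦄ ⟩
      y                             ∎
      where
      q^[j∸M]≤y/q^M : q ^ (j ∸ M) ≤ y /q^ M
      q^[j∸M]≤y/q^M = begin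
        q ^ (j ∸ M)                 ≡⟨ m*n/n≡m (q ^ (j ∸ M)) (q ^ M) ⦃ q^≢0 M ⦄ ⟨
        q ^ (j ∸ M) * q ^ M /q^ M   ≡⟨ cong (_/q^ M) (q^n≡q^[n∸m]*q^m M≤j) ⟨
        q ^ j /q^ M                 ≤⟨ /q^-≤ M q^j≤x ⟩
        x /q^ M                     ≡⟨ eq ⟩
        y /q^ M                     ∎

  digit-< : ∀ j {x} → x < q ^ j → digit q j x ≡ 0
  digit-< j x<q^j = trans (cong (_% q) (m<n⇒m/n≡0 ⦃ q^≢0 j ⦄ x<q^j)) (m*n%n≡0 0 q)

  digit≡%/ : ∀ j x → digit q j x ≡ x %q^ suc j /q^ j
  digit≡%/ j x = sym (m%[n*o]/o≡m/o%n x q (q ^ j) ⦃ _ ⦄ ⦃ q^≢0 j ⦄ ⦃ q^≢0 (suc j) ⦄)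

  digit-%-< : ∀ {j N} x → j < N → digit q j (x %q^ N) ≡ digit q j x
  digit-%-< {j} {N} x j<N = begin
    digit q j (x %q^ N)            ≡⟨ digit≡%/ j (x %q^ N) ⟩
    x %q^ N %q^ suc j /q^ j        ≡⟨ cong (_/q^ j) (m∣n⇒o%n%m≡o%m (q ^ suc j) (q ^ N) x ⦃ q^≢0 (suc j) ⦄ ⦃ q^≢0 N ⦄ q^1+j∣q^N) ⟩
    x %q^ suc j /q^ j              ≡⟨ digit≡%/ j x ⟨
    digit q j x                    ∎
    where
    open ≡-Reasoning
    q^1+j∣q^N : q ^ suc j ∣ q ^ N
    q^1+j∣q^N = divides (q ^ (N ∸ suc j)) (q^n≡q^[n∸m]*q^m j<N)

  digit-%-≥ : ∀ {j N} x → N ≤ j → digit q j (x %q^ N) ≡ 0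
  digit-%-≥ {j} {N} x N≤j = digit-< j (<-≤-trans (m%n<n x (q ^ N) ⦃ q^≢0 N ⦄) (^-monoʳ-≤ q N≤j))

  digit-cong-/ : ∀ {M j x y} → M ≤ j → x /q^ M ≡ y /q^ M → digit q j x ≡ digit q j y
  digit-cong-/ {M} {j} {x} {y} M≤j eq = cong (_% q) (begin
    x /q^ j                 ≡⟨ /q^j x ⟩
    x /q^ M /q^ (j ∸ M)     ≡⟨ cong (_/q^ (j ∸ M)) eq ⟩
    y /q^ M /q^ (j ∸ M)     ≡⟨ /q^j y ⟨
    y /q^ j                 ∎)
    where
    open ≡-Reasoning
    /q^j : ∀ z → z /q^ j ≡ z /q^ M /q^ (j ∸ M)
    /q^j z = trans (cong (z /q^_) (sym (m+[n∸m]≡n M≤j))) (/q^-+ z M (j ∸ M))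

  Tq-sel : ∀ n → Tq q n ≡ 0 ⊎ q ^ Tq q n ≤ n
  Tq-sel n with foldr-selective ⊔-sel 0 (filter (λ j → q ^ j ≤? n) (upTo (suc n)))
  ... | inj₁ Tq≡0    = inj₁ Tq≡0
  ... | inj₂ Tq∈powers = inj₂ (proj₂ (∈-filter⁻ (λ j → q ^ j ≤? n) {xs = upTo (suc n)} Tq∈powers))

  -- window x L i = ε_i(x) ⋯ ε_{i+L−1}(x); aPxy q P x y is literally the sum of window x (suc (P y)) i over i ≤ x.
  window : ℕ → ℕ → ℕ → ℕ
  window x L i = product (map (λ t → digit q (i + t) x) (upTo L))

  window-%-< : ∀ {N i L} x → i + L ≤ N → window (x %q^ N) L i ≡ window x L i
  window-%-< {i = i} {L} x i+L≤N = product-upTo-cong L (λ t<L → digit-%-< x (<-≤-trans (+-monoʳ-< i t<L) i+L≤N))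

  window-%-≥ : ∀ {N i} L x → N ≤ i + L → window (x %q^ N) (suc L) i ≡ 0
  window-%-≥ {N} {i} L x N≤i+L = product-map-zero (λ t → digit q (i + t) (x %q^ N)) (∈-upTo⁺ (n<1+n L)) (digit-%-≥ x N≤i+L)

  window-cong-/ : ∀ {M i x y} L → M ≤ i → x /q^ M ≡ y /q^ M → window x L i ≡ window y L i
  window-cong-/ {i = i} L M≤i eq = product-upTo-cong L (λ {t} _ → digit-cong-/ (≤-trans M≤i (m≤m+n i t)) eq)

  aPtrunc-< : ∀ P N {x} → x < q ^ N → aPtrunc q P N x ≡ aP q P x
  aPtrunc-< P N {x} x<q^N = cong (λ z → aPxy q P z (Tq q x)) (m<n⇒m%n≡m ⦃ q^≢0 N ⦄ x<q^N)

  module _ (q≥2 : 2 ≤ q) where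

    n<q^n : ∀ n → n < q ^ n
    n<q^n zero    = s≤s z≤n
    n<q^n (suc n) = ≤-<-trans (n<q^n n) (^-monoʳ-< q q≥2 (n<1+n n))

    ≤-Tq : ∀ {j n} → q ^ j ≤ n → j ≤ Tq q n
    ≤-Tq {j} {n} q^j≤n =
      ≤-foldr-⊔ (∈-filter⁺ (λ j → q ^ j ≤? n) {xs = upTo (suc n)} (∈-upTo⁺ (s≤s (≤-trans (<⇒≤ (n<q^n j)) q^j≤n))) q^j≤n)

    Tq-≤ : ∀ {e n} → n < q ^ suc e → Tq q n ≤ e
    Tq-≤ {e} {n} n<q^1+e with Tq-sel n | Tq q n ≤? e
    ... | _             | yes Tq≤e = Tq≤e
    ... | inj₁ Tq≡0     | no _     = subst (_≤ e) (sym Tq≡0) z≤n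
    ... | inj₂ q^Tq≤n   | no Tq≰e  = contradiction (≤-trans (^-monoʳ-≤ q (≰⇒> Tq≰e)) q^Tq≤n) (<⇒≱ n<q^1+e)

    Tq-mono : ∀ {x y} → (∀ j → q ^ j ≤ x → q ^ j ≤ y) → Tq q x ≤ Tq q y
    Tq-mono {x} {y} powers⊆ with Tq-sel x
    ... | inj₁ Tq≡0   = subst (_≤ Tq q y) (sym Tq≡0) z≤n
    ... | inj₂ q^Tq≤x = ≤-Tq (powers⊆ (Tq q x) q^Tq≤x)

    Tq-cong-/ : ∀ M {x y} → q ^ M ≤ x → x /q^ M ≡ y /q^ M → Tq q x ≡ Tq q y
    Tq-cong-/ M q^M≤x eq = ≤-antisym (Tq-mono (q^j≤-cong-/ M q^M≤x eq))
                                     (Tq-mono (q^j≤-cong-/ M (q^M≤-cong-/ M q^M≤x eq) (sym eq)))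

    window-≥ : ∀ {x i} L → x ≤ i → window x (suc L) i ≡ 0
    window-≥ {x} {i} L x≤i = product-map-zero (λ t → digit q (i + t) x) (∈-upTo⁺ {suc L} (s≤s z≤n))
      (digit-< (i + 0) (subst (λ k → x < q ^ k) (sym (+-identityʳ i)) (≤-<-trans x≤i (n<q^n i))))

    aPxy-upTo : ∀ P {x K} y → x ≤ K → aPxy q P x y ≡ sum (map (window x (suc (P y))) (upTo (suc K)))
    aPxy-upTo P y x≤K = sym (sum-upTo-vanishing _ (s≤s x≤K) (λ i x<i → window-≥ (P y) (<⇒≤ x<i)))

    aPxy-%-interchange : ∀ P y {M N x₀ x₁} → M + P y ≤ N → x₀ ≤ x₁ → x₀ /q^ M ≡ x₁ /q^ M →
      aPxy q P x₁ y + aPxy q P (x₀ %q^ N) y ≡ aPxy q P x₀ y + aPxy q P (x₁ %q^ N) y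
    aPxy-%-interchange P y {M} {N} {x₀} {x₁} M+L≤N x₀≤x₁ eq = begin
      aPxy q P x₁ y + aPxy q P (x₀ %q^ N) y
        ≡⟨ cong₂ _+_ (aPxy-upTo P y ≤-refl) (aPxy-upTo P y (≤-trans (m%n≤m x₀ (q ^ N) ⦃ q^≢0 N ⦄) x₀≤x₁)) ⟩
      Σ (w x₁) + Σ (w (x₀ %q^ N))
        ≡⟨ sum-map-interchange {w x₁} {w (x₀ %q^ N)} {w x₀} {w (x₁ %q^ N)} windows-interchange (upTo (suc x₁)) ⟩
      Σ (w x₀) + Σ (w (x₁ %q^ N))
        ≡⟨ cong₂ _+_ (aPxy-upTo P y x₀≤x₁) (aPxy-upTo P y (m%n≤m x₁ (q ^ N) ⦃ q^≢0 N ⦄)) ⟨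
      aPxy q P x₀ y + aPxy q P (x₁ %q^ N) y
        ∎
      where
      open ≡-Reasoning
      L : ℕ
      L = P y
      w : ℕ → ℕ → ℕ
      w x = window x (suc L)
      Σ : (ℕ → ℕ) → ℕ
      Σ f = sum (map f (upTo (suc x₁)))
      windows-interchange : ∀ i → w x₁ i + w (x₀ %q^ N) i ≡ w x₀ i + w (x₁ %q^ N) i
      windows-interchange i with N ≤? i + L
      ... | yes N≤i+L = begin
        w x₁ i + w (x₀ %q^ N) i ≡⟨ cong₂ _+_ (window-cong-/ (suc L) M≤i (sym eq)) (window-%-≥ L x₀ N≤i+L) ⟩
        w x₀ i + 0              ≡⟨ cong (w x₀ i +_) (window-%-≥ L x₁ N≤i+L) ⟨
        w x₀ i + w (x₁ %q^ N) i ∎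
        where
        -- A window reaching digit N starts at or above digit M, where x₀ and x₁ agree.
        M≤i : M ≤ i
        M≤i = +-cancelʳ-≤ L M i (≤-trans M+L≤N N≤i+L)
      ... | no N≰i+L = begin
        w x₁ i + w (x₀ %q^ N) i ≡⟨ cong (w x₁ i +_) (window-%-< x₀ i+[1+L]≤N) ⟩
        w x₁ i + w x₀ i         ≡⟨ +-comm (w x₁ i) (w x₀ i) ⟩
        w x₀ i + w x₁ i         ≡⟨ cong (w x₀ i +_) (window-%-< x₁ i+[1+L]≤N) ⟨
        w x₀ i + w (x₁ %q^ N) i ∎
        where
        i+[1+L]≤N : i + suc L ≤ N
        i+[1+L]≤N = subst (_≤ N) (sym (+-suc i L)) (≰⇒> N≰i+L)

    aP-%-interchange : ∀ P {M N x₀ x₁} → M + P (Tq q x₀) ≤ N → x₀ ≤ x₁ → x₀ /q^ M ≡ x₁ /q^ M →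
      aP q P x₁ + aPtrunc q P N x₀ ≡ aP q P x₀ + aPtrunc q P N x₁
    aP-%-interchange P {M} {N} {x₀} {x₁} M+P≤N x₀≤x₁ eq with q ^ M ≤? x₀
    ... | yes q^M≤x₀ = begin
      aPxy q P x₁ (Tq q x₁) + aPtrunc q P N x₀
        ≡⟨ cong (λ y → aPxy q P x₁ y + aPtrunc q P N x₀) T₀≡T₁ ⟨
      aPxy q P x₁ (Tq q x₀) + aPxy q P (x₀ %q^ N) (Tq q x₀)
        ≡⟨ aPxy-%-interchange P (Tq q x₀) {M} {N} M+P≤N x₀≤x₁ eq ⟩
      aPxy q P x₀ (Tq q x₀) + aPxy q P (x₁ %q^ N) (Tq q x₀)
        ≡⟨ cong (λ y → aP q P x₀ + aPxy q P (x₁ %q^ N) y) T₀≡T₁ ⟩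
      aP q P x₀ + aPtrunc q P N x₁
        ∎
      where
      open ≡-Reasoning
      T₀≡T₁ : Tq q x₀ ≡ Tq q x₁
      T₀≡T₁ = Tq-cong-/ M q^M≤x₀ eq
    ... | no q^M≰x₀ = begin
      aP q P x₁ + aPtrunc q P N x₀ ≡⟨ cong (aP q P x₁ +_) (aPtrunc-< P N (<q^N x₀<q^M)) ⟩
      aP q P x₁ + aP q P x₀        ≡⟨ +-comm (aP q P x₁) (aP q P x₀) ⟩
      aP q P x₀ + aP q P x₁        ≡⟨ cong (aP q P x₀ +_) (aPtrunc-< P N (<q^N x₁<q^M)) ⟨
      aP q P x₀ + aPtrunc q P N x₁ ∎
      where
      open ≡-Reasoning
      x₀<q^M : x₀ < q ^ M
      x₀<q^M = ≰⇒> q^M≰x₀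
      x₁<q^M : x₁ < q ^ M
      x₁<q^M = m/n≡0⇒m<n ⦃ q^≢0 M ⦄ (trans (sym eq) (m<n⇒m/n≡0 ⦃ q^≢0 M ⦄ x₀<q^M))
      <q^N : ∀ {x} → x < q ^ M → x < q ^ N
      <q^N x<q^M = <-≤-trans x<q^M (^-monoʳ-≤ q (≤-trans (m≤m+n M _) M+P≤N))

    l*q^κ+k₁+k₂<q^[1+λ+κ] : ∀ λ' κ {l k₁ k₂} → l < q ^ λ' → k₁ < q ^ κ → k₂ < q ^ κ →
      l * q ^ κ + k₁ + k₂ < q ^ suc (λ' + κ)
    l*q^κ+k₁+k₂<q^[1+λ+κ] λ' κ {l} {k₁} {k₂} l<q^λ k₁<q^κ k₂<q^κ = begin-strict
      l * q ^ κ + k₁ + k₂         <⟨ +-mono-< l*q^κ+k₁<q^[λ+κ] k₂<q^[λ+κ] ⟩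
      q ^ (λ' + κ) + q ^ (λ' + κ) ≡⟨ cong (q ^ (λ' + κ) +_) (+-identityʳ (q ^ (λ' + κ))) ⟨
      2 * q ^ (λ' + κ)            ≤⟨ *-monoˡ-≤ (q ^ (λ' + κ)) q≥2 ⟩
      q ^ suc (λ' + κ)            ∎
      where
      open ≤-Reasoning
      l*q^κ+k₁<q^[λ+κ] : l * q ^ κ + k₁ < q ^ (λ' + κ)
      l*q^κ+k₁<q^[λ+κ] = begin-strict
        l * q ^ κ + k₁    <⟨ +-monoʳ-< (l * q ^ κ) k₁<q^κ ⟩
        l * q ^ κ + q ^ κ ≡⟨ +-comm (l * q ^ κ) (q ^ κ) ⟩
        suc l * q ^ κ     ≤⟨ *-monoˡ-≤ (q ^ κ) l<q^λ ⟩
        q ^ λ' * q ^ κ    ≡⟨ ^-distribˡ-+-* q λ' κ ⟨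
        q ^ (λ' + κ)      ∎
      k₂<q^[λ+κ] : k₂ < q ^ (λ' + κ)
      k₂<q^[λ+κ] = <-≤-trans k₂<q^κ (^-monoʳ-≤ q (m≤n+m κ λ'))

module _ (q : ℕ) .⦃ _ : NonZero q ⦄ (q≥2 : 2 ≤ q) (P : ℕ → ℕ) (P-mono : Nondecreasing P)
         (ρ λ' κ : ℕ) (p≤ρ : P (λ' + κ + 1) ≤ ρ) where

  open Digits q

  private
    p r : ℕ
    p = P (λ' + κ + 1)
    r = ρ ∸ p

  aP-increment≡aPtrunc-increment : ∀ {l k₁ k₂} → ¬ q ^ r ∣ suc l → l < q ^ λ' → k₁ < q ^ κ → k₂ < q ^ κ →
    ℤ.+ aP q P (l * q ^ κ + k₁ + k₂) ℤ.- ℤ.+ aP q P (l * q ^ κ + k₁)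
      ≡ ℤ.+ aPtrunc q P (κ + ρ) (l * q ^ κ + k₁ + k₂) ℤ.- ℤ.+ aPtrunc q P (κ + ρ) (l * q ^ κ + k₁)
  aP-increment≡aPtrunc-increment {l} {k₁} {k₂} q^r∤1+l l<q^λ k₁<q^κ k₂<q^κ =
    m+p≡n+o⇒+m-+n≡+o-+p (aP q P m₁) (aP q P m₀) (aPtrunc q P (κ + ρ) m₁) (aPtrunc q P (κ + ρ) m₀)
      (aP-%-interchange q≥2 P {κ + r} {κ + ρ} M+P[Tq]≤N (m≤m+n m₀ k₂) same-top)
    where
    m₀ m₁ : ℕ
    m₀ = l * q ^ κ + k₁
    m₁ = m₀ + k₂
    same-top : m₀ /q^ (κ + r) ≡ m₁ /q^ (κ + r)
    same-top = begin
      m₀ /q^ (κ + r)   ≡⟨ /q^-+ m₀ κ r ⟩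
      m₀ /q^ κ /q^ r   ≡⟨ /-/-carry-free ⦃ q^≢0 κ ⦄ ⦃ q^≢0 r ⦄ q^r∤1+l k₁<q^κ k₂<q^κ ⟩
      m₁ /q^ κ /q^ r   ≡⟨ /q^-+ m₁ κ r ⟨
      m₁ /q^ (κ + r)   ∎
      where open ≡-Reasoning
    P[Tq]≤p : P (Tq q m₀) ≤ p
    P[Tq]≤p = P-mono _ _ (≤-trans (Tq-≤ q≥2 (≤-<-trans (m≤m+n m₀ k₂) (l*q^κ+k₁+k₂<q^[1+λ+κ] q≥2 λ' κ l<q^λ k₁<q^κ k₂<q^κ)))
                                  (m≤m+n (λ' + κ) 1))
    M+P[Tq]≤N : κ + r + P (Tq q m₀) ≤ κ + ρ
    M+P[Tq]≤N = begin
      κ + r + P (Tq q m₀) ≤⟨ +-monoʳ-≤ (κ + r) P[Tq]≤p ⟩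
      κ + r + p           ≡⟨ +-assoc κ r p ⟩
      κ + (r + p)         ≡⟨ cong (κ +_) (m∸n+n≡m p≤ρ) ⟩
      κ + ρ               ∎
      where open ≤-Reasoning

  inB⇒q^r∣1+l : ∀ {l} → l < q ^ λ' → T (inB q P ρ κ l) → q ^ r ∣ suc l
  inB⇒q^r∣1+l {l} l<q^λ l∈B with q ^ r ∣? suc l
  ... | yes q^r∣1+l = q^r∣1+l
  ... | no q^r∤1+l with find (any⁻ _ (upTo (q ^ κ)) l∈B)
  ...   | k₁ , k₁∈ , some-k₂ with find (any⁻ _ (upTo (q ^ κ)) some-k₂)
  ...     | k₂ , k₂∈ , differ = ⊥-elim (subst (T ∘ not) (dec-true (_ ℤ.≟ _)
    (aP-increment≡aPtrunc-increment q^r∤1+l l<q^λ (∈-upTo⁻ k₁∈) (∈-upTo⁻ k₂∈))) differ)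

  cardB≤q^[λ∸r] : ρ ≤ λ' → cardB q P ρ λ' κ ≤ q ^ (λ' ∸ r)
  cardB≤q^[λ∸r] ρ≤λ = begin
    cardB q P ρ λ' κ                                       ≤⟨ length-filter-mono _ D? (upTo (q ^ λ')) (inB⇒q^r∣1+l ∘ ∈-upTo⁻) ⟩
    length (filter D? (upTo (q ^ λ')))                     ≡⟨ count-∣-suc (q ^ r) ⦃ q^≢0 r ⦄ (q ^ λ') ⟩
    q ^ λ' /q^ r                                           ≡⟨ q^n/q^m≡q^[n∸m] (≤-trans (m∸n≤m ρ p) ρ≤λ) ⟩
    q ^ (λ' ∸ r)                                           ∎
    where
    open ≤-Reasoning
    D? : Decidable (λ l → q ^ r ∣ suc l)
    D? l = q ^ r ∣? suc l

lemma4p2 : (q : ℕ) → .⦃ _ : NonZero q ⦄ → 2 ≤ q →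
    ∃[ C ] ((P : ℕ → ℕ) → Nondecreasing P → (ρ λ' κ : ℕ) →
      P (λ' + κ + 1) ≤ ρ → 4 * ρ ≤ 3 * λ' →
      cardB q P ρ λ' κ ≤ C * q ^ (λ' ∸ ρ + P (λ' + κ + 1)))
lemma4p2 q q≥2 = 1 , λ P P-mono ρ λ' κ p≤ρ 4ρ≤3λ →
  let ρ≤λ : ρ ≤ λ'
      ρ≤λ = *-cancelˡ-≤ 4 (≤-trans 4ρ≤3λ (*-monoˡ-≤ λ' (n≤1+n 3)))
  in
  begin
    cardB q P ρ λ' κ               ≤⟨ cardB≤q^[λ∸r] q q≥2 P P-mono ρ λ' κ p≤ρ ρ≤λ ⟩
    q ^ (λ' ∸ (ρ ∸ P (λ' + κ + 1))) ≡⟨ cong (q ^_) (m∸[n∸o]≡m∸n+o p≤ρ ρ≤λ) ⟩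
    q ^ (λ' ∸ ρ + P (λ' + κ + 1))   ≡⟨ *-identityˡ _ ⟨
    1 * q ^ (λ' ∸ ρ + P (λ' + κ + 1)) ∎
  where open ≤-Reasoning
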